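{- Let $1\le t\le r$ be integers. Then \[ R(r,t)\le \begin{cases} \left\lfloor \frac{r-t}{2}\right\rfloor + 1 & \text{if } t\le r\le 3t-1,\\[2pt] 2r-5t+2 & \text{if } 3t\le r\le \frac{26t}{7},\\[2pt] \left\lfloor \frac{9r-14t}{8}\right\rfloor + 2 & \text{if } \frac{26t}{7}\le r\le 5t-2,\\[2pt] \left\lfloor \frac{15r-44t}{8}\right\rfloor + 3 & \text{if } 5t-1\le r\le \frac{52t-13}{9}. \end{cases} \]
   Context: All hypergraphs are finite. An $r$-uniform hypergraph $\mathcal H$ is $r$-partite if its vertex set can be partitioned as $V(\mathcal H)=P_1\sqcup\dots\sqcup P_r$ such that $|e\cap P_j|=1$ for every edge $e$ and every $j\in[r]$. It is $t$-intersecting if $|e\cap f|\ge t$ for all $e,f\in E(\mathcal H)$. An $(r,t)$-graph is an $r$-uniform, $r$-partite, $t$-intersecting hypergraph. A cover of $\mathcal H$ is a set $C\subseteq V(\mathcal H)$ with $C\cap e\neq\emptyset$ for every edge $e$; the cover number $\tau(\mathcal H)$ is the minimum size of a cover. $R(r,t)$ denotes the maximum of $\tau(\mathcal H)$ over all $(r,t)$-graphs $\mathcal H$. -}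

module Defs where

open import Data.Nat using (ℕ; _≤_; _≡ᵇ_)
open import Data.Fin using (Fin; _≟_)
open import Data.Fin.Subset using (Subset; _∩_; ∣_∣; Nonempty)
open import Data.Vec using (tabulate)
open import Data.List using (List)
open import Data.List.Membership.Propositional using (_∈_)
open import Data.Product using (∃; _×_)
open import Relation.Binary.PropositionalEquality using (_≡_)
open import Relation.Nullary.Decidable using (⌊_⌋)

record Hypergraph : Set where
  field
    n     : ℕ
    edges : List (Subset n)
open Hypergraph public

classOf : ∀ {n r} → (Fin n → Fin r) → Fin r → Subset n
classOf part j = tabulate (λ x → ⌊ part x ≟ j ⌋)

Uniform : ℕ → Hypergraph → Set
Uniform r H = ∀ e → e ∈ edges H → ∣ e ∣ ≡ r

Partite : ℕ → Hypergraph → Set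
Partite r H = ∃ λ (part : Fin (n H) → Fin r) →
  ∀ e → e ∈ edges H → ∀ j → ∣ e ∩ classOf part j ∣ ≡ 1

Intersecting : ℕ → Hypergraph → Set
Intersecting t H = ∀ e f → e ∈ edges H → f ∈ edges H → t ≤ ∣ e ∩ f ∣

RTGraph : ℕ → ℕ → Hypergraph → Set
RTGraph r t H = Uniform r H × Partite r H × Intersecting t H

IsCover : (H : Hypergraph) → Subset (n H) → Set
IsCover H C = ∀ e → e ∈ edges H → Nonempty (C ∩ e)

CoverNumberAtMost : Hypergraph → ℕ → Set
CoverNumberAtMost H b = ∃ λ C → IsCover H C × ∣ C ∣ ≤ b

RAtMost : ℕ → ℕ → ℕ → Set
RAtMost r t b = ∀ (H : Hypergraph) → RTGraph r t H → CoverNumberAtMost H b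

{-# OPTIONS --safe #-}

-- The vertex of an edge in each class turns edges into words of length r that
-- pairwise agree in at least t positions.  Let m ≥ t be the least agreement,
-- attained by e and f.
--
-- Every cover is found by counting.  Fix a few words, remove some vertices and
-- bound, position by position, how many of the fixed words a vertex that is left
-- can lie on; as soon as these bounds sum to less than (number of words) · m, the
-- removed vertices form a cover.
--
-- With e and f alone, vertices of e ∩ f suffice when r < 3m, and e ∩ f together
-- with both vertices at r - 3m + 1 further positions otherwise.  For larger r, look
-- at c vertices of e ∩ f together with r - 2m + q vertices of e outside f.  If this
-- is not a cover, some g misses it, so that q ≤ |e ∩ f ∩ g| ≤ m - c while |e ∩ g| stays small.
-- Either f ∩ g is of a size for which the two-word argument on f and g succeeds,
-- or e, f and g, whose triple intersection is neither small nor large, give a cover.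
-- The values of c and q are those which balance the two ends of this range.

module Submission where

open import Defs
open import Data.Nat using (ℕ; _+_; _*_; _∸_; _/_; _≤_)
open import Data.Nat using (zero; suc; _<_; _≤?_; _<?_; _⊓_; _%_; z≤n; s≤s; s≤s⁻¹; NonZero)
open import Data.Product using (_×_)
open import Data.Product using (∃; _,_; proj₁; proj₂)
import Data.Nat.Properties
open import Algebra.Properties.CommutativeMonoid.Sum Data.Nat.Properties.+-0-commutativeMonoid
  using (sum; sum-cong-≗; ∑-distrib-+)
open import Algebra.Properties.Semiring.Sum Data.Nat.Properties.+-*-semiring using (*-distribˡ-sum)
open import Data.Bool using (true; false; if_then_else_)
open import Data.Fin as Fin using (Fin; zero; suc)
open import Data.Fin.Properties using (any?; all?; ¬∀⟶∃¬)
open import Data.Fin.Subset using (Subset; inside; outside; _⊆_; _∩_; _∪_; ∣_∣; ⁅_⁆)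
  renaming (_∈_ to _∈ˢ_; ⊥ to ∅)
open import Data.Fin.Subset.Properties
  using (x∈p∩q⁺; x∈p∩q⁻; x∈p∪q⁺; x∈⁅x⁆; ∣⊥∣≡0; ∣⁅x⁆∣≡1; x∈p∧x≢y⇒x∈p-y; x∈p⇒∣p-x∣<∣p∣;
         nonempty?; Empty-unique; p⊆q⇒∣p∣≤∣q∣)
open import Data.List using (List; []; _∷_; length; concat; tabulate; lookup)
import Data.List.Membership.DecPropositional as DecMembership
open import Data.List.Membership.Propositional using (_∈_; _∉_)
open import Data.List.Membership.Propositional.Properties using (∈-concat⁺′; ∈-tabulate⁺; ∈-lookup)
open import Data.List.Properties using (length-++)
open import Data.List.Relation.Unary.Any using (here; there; index)
open import Data.List.Relation.Unary.Any.Properties using (lookup-index)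
open import Data.Nat.DivMod using (m≡m%n+[m/n]*n; m%n<n)
open import Data.Nat.Properties
open import Data.Nat.Tactic.RingSolver using (solve)
open import Data.Sum using (_⊎_; inj₁; inj₂)
import Data.Vec as Vec
open import Function using (_∘_)
open import Relation.Binary.Definitions using (DecidableEquality)
open import Relation.Binary.PropositionalEquality
open import Relation.Nullary using (yes; no; does; contradiction)
open import Relation.Nullary.Decidable using (⌊_⌋; isYes≗does)

-- Combination of linear inequalities.

infixl 6 _⊕_
infixl 7 _⊗_

_⊕_ : ∀ {w x y z} → w ≤ x → y ≤ z → w + y ≤ x + z
_⊕_ = +-mono-≤

_⊗_ : ∀ k {x y} → x ≤ y → k * x ≤ k * y
k ⊗ x≤y = *-monoʳ-≤ k x≤y

-- From y - x ≥ 0 and b - a = y - x, without subtraction: linear inequalities become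
-- semiring identities.
≤-by : ∀ {x y a b} → x ≤ y → a + y ≡ b + x → a ≤ b
≤-by {x} {y} {a} {b} x≤y eq = +-cancelʳ-≤ x a b (≤-trans (+-monoʳ-≤ a x≤y) (≤-reflexive eq))

-- Finite sums and minima of natural numbers.

sum-mono : ∀ {n} {f g : Fin n → ℕ} → (∀ i → f i ≤ g i) → sum f ≤ sum g
sum-mono {zero}  f≤g = z≤n
sum-mono {suc n} f≤g = +-mono-≤ (f≤g zero) (sum-mono (f≤g ∘ suc))

sum-1 : ∀ n → sum {n} (λ _ → 1) ≡ n
sum-1 zero    = refl
sum-1 (suc n) = cong suc (sum-1 n)

sum-0 : ∀ n → sum {n} (λ _ → 0) ≡ 0
sum-0 zero    = refl
sum-0 (suc n) = sum-0 n

distribute : ∀ {n} (β : Fin n → ℕ) m → m ≤ sum β →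
             ∃ λ u → (∀ i → u i ≤ β i) × sum u ≡ m
distribute {zero}  β zero m≤ = (λ ()) , (λ ()) , refl
distribute {suc n} β m m≤
  with u , u≤ , Σu ← distribute (β ∘ suc) (m ∸ β zero) (m≤n+o⇒m∸n≤o m (β zero) m≤)
  = (λ { zero → β zero ⊓ m ; (suc i) → u i })
  , (λ { zero → m⊓n≤m (β zero) m ; (suc i) → u≤ i })
  , trans (cong (β zero ⊓ m +_) Σu) (m⊓n+n∸m≡n (β zero) m)

argmin : ∀ {n} (f : Fin (suc n) → ℕ) → ∃ λ i → ∀ j → f i ≤ f j
argmin {zero}  f = zero , λ { zero → ≤-refl }
argmin {suc n} f with argmin (f ∘ suc)
... | i , f≤ with f zero ≤? f (suc i)
...   | yes p = zero , λ { zero → ≤-refl ; (suc j) → ≤-trans p (f≤ j) }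
...   | no ¬p = suc i , λ { zero → ≰⇒≥ ¬p ; (suc j) → f≤ j }

-- Coincidences among letters at a single position.

module Words {V : Set} (_≟ᵛ_ : DecidableEquality V) where

  open DecMembership _≟ᵛ_ using (_∈?_)

  δ : V → V → ℕ
  δ x y = if does (x ≟ᵛ y) then 1 else 0

  δ-refl : ∀ x → δ x x ≡ 1
  δ-refl x with x ≟ᵛ x
  ... | yes _  = refl
  ... | no x≢x = contradiction refl x≢x

  δ-≢ : ∀ {x y} → x ≢ y → δ x y ≡ 0
  δ-≢ {x} {y} x≢y with x ≟ᵛ y
  ... | yes x≡y = contradiction x≡y x≢y
  ... | no _    = refl

  δ≤1 : ∀ x y → δ x y ≤ 1
  δ≤1 x y with x ≟ᵛ y
  ... | yes _ = ≤-refl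
  ... | no _  = z≤n

  -- Indicators that the letters take one, two or three different values. Three equal letters give 3
  -- equal pairs and exactly two equal letters give 1, so both truncated subtractions are exact.
  all₃ two₃ none₃ : V → V → V → ℕ
  all₃  x y z = δ x y * δ x z
  two₃  x y z = (δ x y + δ x z + δ y z) ∸ 3 * all₃ x y z
  none₃ x y z = 1 ∸ (all₃ x y z + two₃ x y z)

  private
    ∉-head : ∀ {v x : V} {xs} → v ∉ x ∷ xs → x ≢ v
    ∉-head v∉ refl = v∉ (here refl)

    ∉-tail : ∀ {v x : V} {xs} → v ∉ x ∷ xs → v ∉ xs
    ∉-tail v∉ = v∉ ∘ there

  -- The indices are the values of `all₃`, `two₃` and `none₃`, so one case distinction fixes all
  -- three.
  data Shape (x y z : V) : ℕ → ℕ → ℕ → Set where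
    equal    : x ≡ y → x ≡ z → Shape x y z 1 0 0
    odd-z    : x ≡ y → x ≢ z → Shape x y z 0 1 0
    odd-y    : x ≡ z → x ≢ y → Shape x y z 0 1 0
    odd-x    : y ≡ z → x ≢ y → Shape x y z 0 1 0
    distinct : x ≢ y → x ≢ z → y ≢ z → Shape x y z 0 0 1

  shape : ∀ x y z → Shape x y z (all₃ x y z) (two₃ x y z) (none₃ x y z)
  shape x y z with x ≟ᵛ y | x ≟ᵛ z | y ≟ᵛ z
  ... | yes p | yes q | yes _ = equal p q
  ... | yes p | yes q | no ¬c = contradiction (trans (sym p) q) ¬c
  ... | yes p | no ¬q | yes c = contradiction (trans p c) ¬q
  ... | yes p | no ¬q | no _  = odd-z p ¬q
  ... | no ¬p | yes q | yes c = contradiction (trans q (sym c)) ¬p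
  ... | no ¬p | yes q | no _  = odd-y q ¬p
  ... | no ¬p | no _  | yes c = odd-x c ¬p
  ... | no ¬p | no ¬q | no ¬c = distinct ¬p ¬q ¬c

  partition₃ : ∀ x y z → all₃ x y z + two₃ x y z + none₃ x y z ≡ 1
  partition₃ x y z with all₃ x y z | two₃ x y z | none₃ x y z | shape x y z
  ... | _ | _ | _ | equal _ _      = refl
  ... | _ | _ | _ | odd-z _ _      = refl
  ... | _ | _ | _ | odd-y _ _      = refl
  ... | _ | _ | _ | odd-x _ _      = refl
  ... | _ | _ | _ | distinct _ _ _ = refl

  pairs₃ : ∀ x y z → δ x y + δ x z + δ y z ≡ 3 * all₃ x y z + two₃ x y z
  pairs₃ x y z with all₃ x y z | two₃ x y z | none₃ x y z | shape x y z
  ... | _ | _ | _ | equal refl refl rewrite δ-refl x = refl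
  ... | _ | _ | _ | odd-z refl q rewrite δ-refl x | δ-≢ q = refl
  ... | _ | _ | _ | odd-y refl q rewrite δ-refl x | δ-≢ q | δ-≢ (q ∘ sym) = refl
  ... | _ | _ | _ | odd-x refl q rewrite δ-refl y | δ-≢ q = refl
  ... | _ | _ | _ | distinct p q c rewrite δ-≢ p | δ-≢ q | δ-≢ c = refl

  -- Effect of removing vertices at a single position.

  Avoiding : List V → (V → Set) → Set
  Avoiding L P = ∀ v → v ∉ L → P v

  δ-distinct : ∀ {x y} → x ≢ y → ∀ v → δ x v + δ y v ≤ 1
  δ-distinct {x} {y} x≢y v with x ≟ᵛ v | y ≟ᵛ v
  ... | yes refl | yes q = contradiction (sym q) x≢y
  ... | yes _ | no _  = ≤-refl
  ... | no _  | yes _ = ≤-refl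
  ... | no _  | no _  = z≤n

  δ₃-distinct : ∀ {x y z} → x ≢ y → x ≢ z → y ≢ z → ∀ v → δ x v + δ y v + δ z v ≤ 1
  δ₃-distinct {x} {y} {z} x≢y x≢z y≢z v with x ≟ᵛ v | y ≟ᵛ v | z ≟ᵛ v
  ... | yes refl | yes q | _      = contradiction (sym q) x≢y
  ... | yes refl | no _  | yes q  = contradiction (sym q) x≢z
  ... | yes _ | no _  | no _      = ≤-refl
  ... | no _  | yes refl | yes q  = contradiction (sym q) y≢z
  ... | no _  | yes _ | no _      = ≤-refl
  ... | no _  | no _  | yes _     = ≤-refl
  ... | no _  | no _  | no _      = z≤n

  -- Removals lower the number of fixed words that a remaining vertex `v` can lie on, here from 1 to
  -- `1 - u`.
  remove-one : ∀ x u → u ≤ 1 → ∃ λ L → length L ≤ u × Avoiding L (λ v → δ x v + u ≤ 1)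
  remove-one x zero u≤ = [] , z≤n , λ v _ → ≤-trans (≤-reflexive (+-identityʳ _)) (δ≤1 x v)
  remove-one x (suc zero) u≤ = x ∷ [] , ≤-refl , avoiding
    where
    avoiding : Avoiding (x ∷ []) (λ v → δ x v + 1 ≤ 1)
    avoiding v v∉ rewrite δ-≢ (∉-head v∉) = ≤-refl
  remove-one x (suc (suc _)) (s≤s ())

  -- For letters `x`, `x`, `y` a vertex counts at most 2. The repeated letter has to go first:
  -- removing `x` leaves at most 1, removing `y` too leaves 0.
  remove-majority : ∀ {x y} → x ≢ y → ∀ k → k ≤ 2 →
    ∃ λ L → length L ≤ k × Avoiding L (λ v → (δ x v + δ x v + δ y v) + k ≤ 2)
  remove-majority {x} {y} x≢y zero k≤2 = [] , z≤n , λ v _ → begin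
    δ x v + δ x v + δ y v + 0   ≡⟨ lemma (δ x v) (δ y v) ⟩
    δ x v + (δ x v + δ y v)     ≤⟨ +-mono-≤ (δ≤1 x v) (δ-distinct x≢y v) ⟩
    2                           ∎
    where
    open ≤-Reasoning
    lemma : ∀ a b → a + a + b + 0 ≡ a + (a + b)
    lemma a b = solve (a ∷ b ∷ [])
  remove-majority {x} {y} x≢y (suc zero) k≤2 = x ∷ [] , ≤-refl , avoiding
    where
    avoiding : Avoiding (x ∷ []) (λ v → (δ x v + δ x v + δ y v) + 1 ≤ 2)
    avoiding v v∉ rewrite δ-≢ (∉-head v∉) = +-monoˡ-≤ 1 (δ≤1 y v)
  remove-majority {x} {y} x≢y (suc (suc zero)) k≤2 = x ∷ y ∷ [] , ≤-refl , avoiding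
    where
    avoiding : Avoiding (x ∷ y ∷ []) (λ v → (δ x v + δ x v + δ y v) + 2 ≤ 2)
    avoiding v v∉ rewrite δ-≢ (∉-head v∉) | δ-≢ (∉-head (∉-tail v∉)) = ≤-refl
  remove-majority x≢y (suc (suc (suc _))) (s≤s (s≤s ()))

  -- 2 * two₃ + none₃ is the largest number of x, y, z equal to a single vertex once
  -- the vertex common to all three, if there is one, has been removed.
  remove-three : ∀ x y z k d → k ≤ 2 * two₃ x y z → d ≤ none₃ x y z →
    ∃ λ L → length L ≤ all₃ x y z + k + 3 * d ×
            Avoiding L (λ v → (δ x v + δ y v + δ z v) + (k + d) ≤ 2 * two₃ x y z + none₃ x y z)
  remove-three x y z k d k≤ d≤ with all₃ x y z | two₃ x y z | none₃ x y z | shape x y z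
  remove-three x y z zero zero k≤ d≤ | _ | _ | _ | equal refl refl = x ∷ [] , ≤-refl , avoiding
    where
    avoiding : Avoiding (x ∷ []) (λ v → (δ x v + δ x v + δ x v) + 0 ≤ 0)
    avoiding v v∉ rewrite δ-≢ (∉-head v∉) = ≤-refl
  remove-three x y z k zero k≤ d≤ | _ | _ | _ | odd-z refl q
    with L , len , blk ← remove-majority q k k≤
    = L , ≤-trans len (m≤m+n k 0) , λ v v∉ →
      ≤-trans (≤-reflexive (lemma (δ x v) (δ z v) k)) (blk v v∉)
    where
    lemma : ∀ a b k → a + a + b + (k + 0) ≡ a + a + b + k
    lemma a b k = solve (a ∷ b ∷ k ∷ [])
  remove-three x y z k zero k≤ d≤ | _ | _ | _ | odd-y refl q
    with L , len , blk ← remove-majority q k k≤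
    = L , ≤-trans len (m≤m+n k 0) , λ v v∉ →
      ≤-trans (≤-reflexive (lemma (δ x v) (δ y v) k)) (blk v v∉)
    where
    lemma : ∀ a b k → a + b + a + (k + 0) ≡ a + a + b + k
    lemma a b k = solve (a ∷ b ∷ k ∷ [])
  remove-three x y z k zero k≤ d≤ | _ | _ | _ | odd-x refl q
    with L , len , blk ← remove-majority (q ∘ sym) k k≤
    = L , ≤-trans len (m≤m+n k 0) , λ v v∉ →
      ≤-trans (≤-reflexive (lemma (δ x v) (δ y v) k)) (blk v v∉)
    where
    lemma : ∀ a b k → a + b + b + (k + 0) ≡ b + b + a + k
    lemma a b k = solve (a ∷ b ∷ k ∷ [])
  remove-three x y z zero zero k≤ d≤ | _ | _ | _ | distinct p q c =
    [] , z≤n , λ v _ → ≤-trans (≤-reflexive (+-identityʳ _)) (δ₃-distinct p q c v)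
  remove-three x y z zero (suc zero) k≤ d≤ | _ | _ | _ | distinct p q c =
    x ∷ y ∷ z ∷ [] , ≤-refl , avoiding
    where
    avoiding : Avoiding (x ∷ y ∷ z ∷ []) (λ v → (δ x v + δ y v + δ z v) + 1 ≤ 1)
    avoiding v v∉ rewrite δ-≢ (∉-head v∉) | δ-≢ (∉-head (∉-tail v∉))
                      | δ-≢ (∉-head (∉-tail (∉-tail v∉))) = ≤-refl
  remove-three x y z zero (suc (suc _)) k≤ (s≤s ()) | _ | _ | _ | distinct p q c

  -- Where the words agree, one removal gains 2. Where they differ, removing one letter gains
  -- nothing, as the other still counts 1; removing both gains 1.
  remove-two : ∀ x y u d → u ≤ δ x y → d ≤ 1 ∸ δ x y →
    ∃ λ L → length L ≤ u + 2 * d ×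
            Avoiding L (λ v → (δ x v + δ y v) + (2 * u + d) ≤ 1 + δ x y)
  remove-two x y u d u≤ d≤ with x ≟ᵛ y
  remove-two x y zero zero u≤ d≤ | yes refl =
    [] , z≤n , λ v _ → ≤-trans (≤-reflexive (+-identityʳ _)) (+-mono-≤ (δ≤1 x v) (δ≤1 x v))
  remove-two x y (suc zero) zero u≤ d≤ | yes refl = x ∷ [] , ≤-refl , avoiding
    where
    avoiding : Avoiding (x ∷ []) (λ v → (δ x v + δ x v) + 2 ≤ 2)
    avoiding v v∉ rewrite δ-≢ (∉-head v∉) = ≤-refl
  remove-two x y (suc (suc _)) zero (s≤s ()) d≤ | yes refl
  remove-two x y zero zero u≤ d≤ | no x≢y =
    [] , z≤n , λ v _ → ≤-trans (≤-reflexive (+-identityʳ _)) (δ-distinct x≢y v)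
  remove-two x y zero (suc zero) u≤ d≤ | no x≢y = x ∷ y ∷ [] , ≤-refl , avoiding
    where
    avoiding : Avoiding (x ∷ y ∷ []) (λ v → (δ x v + δ y v) + 1 ≤ 1)
    avoiding v v∉ rewrite δ-≢ (∉-head v∉) | δ-≢ (∉-head (∉-tail v∉)) = ≤-refl
  remove-two x y zero (suc (suc _)) u≤ (s≤s ()) | no x≢y

  -- Only `x` is ever removed, and `v` will be the letter of a third word. If `x` and `y` agree, a
  -- removal excludes a triple coincidence and the second inequality is an equality; otherwise a
  -- removal excludes `v ≡ x`.
  remove-towards-third : ∀ x y u d → u ≤ δ x y → d ≤ 1 ∸ δ x y →
    ∃ λ L → length L ≤ u + d ×
            Avoiding L (λ v → all₃ x y v + u ≤ δ x y × δ x v + d + δ x y ≤ 1 + all₃ x y v)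
  remove-towards-third x y u d u≤ d≤ with x ≟ᵛ y
  remove-towards-third x y zero zero u≤ d≤ | no _ =
    [] , z≤n , λ v _ → ≤-refl , ≤-trans (≤-reflexive (+-identityʳ _)) (+-monoˡ-≤ 0 (δ≤1 x v))
  remove-towards-third x y zero (suc zero) u≤ d≤ | no _ = x ∷ [] , ≤-refl , avoiding
    where
    avoiding : Avoiding (x ∷ []) (λ v → 0 ≤ 0 × δ x v + 1 + 0 ≤ 1)
    avoiding v v∉ rewrite δ-≢ (∉-head v∉) = ≤-refl , ≤-refl
  remove-towards-third x y zero (suc (suc _)) u≤ (s≤s ()) | no _
  remove-towards-third x y zero zero u≤ d≤ | yes _ =
    [] , z≤n , λ v _ → ≤-trans (≤-reflexive (lemma (δ x v))) (δ≤1 x v)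
                     , ≤-reflexive (lemma′ (δ x v))
    where
    lemma : ∀ a → a + 0 + 0 ≡ a
    lemma a = solve (a ∷ [])
    lemma′ : ∀ a → a + 0 + 1 ≡ 1 + (a + 0)
    lemma′ a = solve (a ∷ [])
  remove-towards-third x y (suc zero) zero u≤ d≤ | yes _ = x ∷ [] , ≤-refl , avoiding
    where
    avoiding : Avoiding (x ∷ []) (λ v → 1 * δ x v + 1 ≤ 1 × δ x v + 0 + 1 ≤ 1 + 1 * δ x v)
    avoiding v v∉ rewrite δ-≢ (∉-head v∉) = ≤-refl , ≤-refl
  remove-towards-third x y (suc (suc _)) zero (s≤s ()) d≤ | yes _

  agree : ∀ {r} → (Fin r → V) → (Fin r → V) → ℕ
  agree x y = sum (λ j → δ (x j) (y j))

  -- Covers of a family of words by counting.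

  module Family {N r} (W : Fin N → Fin r → V) where

    Coverable : ℕ → Set
    Coverable b = ∃ λ (C : Fin r → List V) → sum (λ j → length (C j)) ≤ b ×
                  ∀ i → ∃ λ j → W i j ∈ C j

    weaken : ∀ {a b} → Coverable a → a ≤ b → Coverable b
    weaken (C , size , covers) a≤b = C , ≤-trans size a≤b , covers

    Missed : (Fin r → V → Set) → Set
    Missed P = ∃ λ h → ∀ j → P j (W h j)

    -- The dichotomy behind every cover: a word that meets none of the lists has a remaining vertex
    -- at every position, so it satisfies every local bound.
    cover-or-missed : ∀ {P : Fin r → V → Set} {w : Fin r → ℕ} →
      (∀ j → ∃ λ L → length L ≤ w j × Avoiding L (P j)) →
      Coverable (sum w) ⊎ Missed P
    cover-or-missed L with all? (λ i → any? (λ j → W i j ∈? proj₁ (L j)))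
    ... | yes covers = inj₁ (proj₁ ∘ L , sum-mono (proj₁ ∘ proj₂ ∘ L) , covers)
    ... | no ¬covers
      with h , missed ← ¬∀⟶∃¬ N _ (λ i → any? (λ j → W i j ∈? proj₁ (L j))) ¬covers
      = inj₂ (h , λ j → proj₂ (proj₂ (L j)) (W h j) (λ h∈ → missed (j , h∈)))

    agree-complement : ∀ (x y : Fin r → V) → agree x y + sum (λ j → 1 ∸ δ (x j) (y j)) ≡ r
    agree-complement x y = begin
      sum (λ j → δ (x j) (y j)) + sum (λ j → 1 ∸ δ (x j) (y j))
        ≡⟨ ∑-distrib-+ (λ j → δ (x j) (y j)) (λ j → 1 ∸ δ (x j) (y j)) ⟨
      sum (λ j → δ (x j) (y j) + (1 ∸ δ (x j) (y j)))
        ≡⟨ sum-cong-≗ (λ j → m+[n∸m]≡n (δ≤1 (x j) (y j))) ⟩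
      sum {r} (λ _ → 1)
        ≡⟨ sum-1 r ⟩
      r ∎
      where open ≡-Reasoning

    distribute-agree : ∀ (x y : Fin r → V) m → m ≤ agree x y →
      ∃ λ u → (∀ j → u j ≤ δ (x j) (y j)) × sum u ≡ m
    distribute-agree x y = distribute (λ j → δ (x j) (y j))

    distribute-disagree : ∀ (x y : Fin r → V) m → m + agree x y ≤ r →
      ∃ λ u → (∀ j → u j ≤ 1 ∸ δ (x j) (y j)) × sum u ≡ m
    distribute-disagree x y m m≤ = distribute (λ j → 1 ∸ δ (x j) (y j)) m
      (+-cancelˡ-≤ (agree x y) _ _
        (≤-trans (≤-reflexive (+-comm (agree x y) m))
          (≤-trans m≤ (≤-reflexive (sym (agree-complement x y))))))

    Σ+ : ∀ (f g : Fin r → ℕ) → sum (λ j → f j + g j) ≡ sum f + sum g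
    Σ+ = ∑-distrib-+

    Σ* : ∀ k (f : Fin r → ℕ) → sum (λ j → k * f j) ≡ k * sum f
    Σ* k f = sym (*-distribˡ-sum k f)

    Σ1+ : ∀ (f : Fin r → ℕ) → sum (λ j → 1 + f j) ≡ r + sum f
    Σ1+ f = trans (Σ+ (λ _ → 1) f) (cong (_+ sum f) (sum-1 r))

    module PairwiseAgree (t : ℕ) (inter : ∀ i k → t ≤ agree (W i) (W k)) where

      single-cover : ∀ (e : Fin N) n → n ≤ r → r < t + n → Coverable n
      single-cover e n n≤r r<t+n
        with u , u≤ , Σu ← distribute (λ _ → 1) n (≤-trans n≤r (≤-reflexive (sym (sum-1 r))))
        with cover-or-missed (λ j → remove-one (W e j) (u j) (u≤ j))
      ... | inj₁ cover = weaken cover (≤-reflexive Σu)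
      ... | inj₂ (h , missed) = contradiction r<t+n (≤⇒≯ (begin
        t + n                                       ≤⟨ +-mono-≤ (inter e h) (≤-reflexive (sym Σu)) ⟩
        agree (W e) (W h) + sum u                   ≡⟨ Σ+ _ u ⟨
        sum (λ j → δ (W e j) (W h j) + u j)         ≤⟨ sum-mono missed ⟩
        sum {r} (λ _ → 1)                           ≡⟨ sum-1 r ⟩
        r                                           ∎))
        where open ≤-Reasoning

      -- A missed word has at least `2t` coincidences with `e` and `f`, while the positions allow
      -- `r + |e ∩ f|`, less 2 for each of the `n` common vertices and 1 for each of the `k` pairs
      -- removed.
      pair-cover : ∀ e f n k → n ≤ agree (W e) (W f) → k + agree (W e) (W f) ≤ r →
        agree (W e) (W f) + r < 2 * t + 2 * n + k → Coverable (n + 2 * k)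
      pair-cover e f n k n≤ k≤ bound
        with u , u≤ , Σu ← distribute-agree (W e) (W f) n n≤
        with d , d≤ , Σd ← distribute-disagree (W e) (W f) k k≤
        with cover-or-missed (λ j → remove-two (W e j) (W f j) (u j) (d j) (u≤ j) (d≤ j))
      ... | inj₁ cover = weaken cover (≤-reflexive size)
        where
        size : sum (λ j → u j + 2 * d j) ≡ n + 2 * k
        size = trans (Σ+ u _) (cong₂ _+_ Σu (trans (Σ* 2 d) (cong (2 *_) Σd)))
      ... | inj₂ (h , missed) = contradiction bound (≤⇒≯ (begin
        2 * t + 2 * n + k
          ≡⟨ lemma t n k ⟩
        t + t + (2 * n + k)
          ≤⟨ +-monoˡ-≤ _ (+-mono-≤ (inter e h) (inter f h)) ⟩
        agree (W e) (W h) + agree (W f) (W h) + (2 * n + k)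
          ≡⟨ cong₂ _+_ (Σ+ (λ j → δ (W e j) (W h j)) _) gain ⟨
        sum (λ j → δ (W e j) (W h j) + δ (W f j) (W h j)) + sum (λ j → 2 * u j + d j)
          ≡⟨ Σ+ _ _ ⟨
        sum (λ j → (δ (W e j) (W h j) + δ (W f j) (W h j)) + (2 * u j + d j))
          ≤⟨ sum-mono missed ⟩
        sum (λ j → 1 + δ (W e j) (W f j))
          ≡⟨ Σ1+ _ ⟩
        r + agree (W e) (W f)
          ≡⟨ +-comm r _ ⟩
        agree (W e) (W f) + r ∎))
        where
        open ≤-Reasoning
        lemma : ∀ t n k → 2 * t + 2 * n + k ≡ t + t + (2 * n + k)
        lemma t n k = solve (t ∷ n ∷ k ∷ [])
        gain : sum (λ j → 2 * u j + d j) ≡ 2 * n + k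
        gain = trans (Σ+ _ d) (cong₂ _+_ (trans (Σ* 2 u) (cong (2 *_) Σu)) Σd)

      all₃Σ two₃Σ none₃Σ : Fin N → Fin N → Fin N → ℕ
      all₃Σ  e f g = sum (λ j → all₃ (W e j) (W f j) (W g j))
      two₃Σ  e f g = sum (λ j → two₃ (W e j) (W f j) (W g j))
      none₃Σ e f g = sum (λ j → none₃ (W e j) (W f j) (W g j))

      partitionΣ : ∀ e f g → all₃Σ e f g + two₃Σ e f g + none₃Σ e f g ≡ r
      partitionΣ e f g = begin
        all₃Σ e f g + two₃Σ e f g + none₃Σ e f g
          ≡⟨ cong (_+ none₃Σ e f g) (Σ+ _ _) ⟨
        sum (λ j → all₃ (W e j) (W f j) (W g j) + two₃ (W e j) (W f j) (W g j)) + none₃Σ e f g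
          ≡⟨ Σ+ _ _ ⟨
        sum (λ j → all₃ (W e j) (W f j) (W g j) + two₃ (W e j) (W f j) (W g j)
                   + none₃ (W e j) (W f j) (W g j))
          ≡⟨ sum-cong-≗ (λ j → partition₃ (W e j) (W f j) (W g j)) ⟩
        sum {r} (λ _ → 1)
          ≡⟨ sum-1 r ⟩
        r ∎
        where open ≡-Reasoning

      pairsΣ : ∀ e f g → agree (W e) (W f) + agree (W e) (W g) + agree (W f) (W g)
                         ≡ 3 * all₃Σ e f g + two₃Σ e f g
      pairsΣ e f g = begin
        agree (W e) (W f) + agree (W e) (W g) + agree (W f) (W g)
          ≡⟨ cong (_+ agree (W f) (W g)) (Σ+ (λ j → δ (W e j) (W f j)) _) ⟨
        sum (λ j → δ (W e j) (W f j) + δ (W e j) (W g j)) + agree (W f) (W g)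
          ≡⟨ Σ+ _ _ ⟨
        sum (λ j → δ (W e j) (W f j) + δ (W e j) (W g j) + δ (W f j) (W g j))
          ≡⟨ sum-cong-≗ (λ j → pairs₃ (W e j) (W f j) (W g j)) ⟩
        sum (λ j → 3 * all₃ (W e j) (W f j) (W g j) + two₃ (W e j) (W f j) (W g j))
          ≡⟨ Σ+ _ _ ⟩
        sum (λ j → 3 * all₃ (W e j) (W f j) (W g j)) + two₃Σ e f g
          ≡⟨ cong (_+ two₃Σ e f g) (Σ* 3 _) ⟩
        3 * all₃Σ e f g + two₃Σ e f g ∎
        where open ≡-Reasoning

      -- All common vertices go first, which leaves a capacity of `2 * two₃Σ + none₃Σ`. Each of the
      -- `k` further vertices and `d` complete triples then gains 1 against the `3t` coincidences of
      -- a missed word.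
      triple-cover : ∀ e f g k d → k ≤ 2 * two₃Σ e f g → d ≤ none₃Σ e f g →
        2 * two₃Σ e f g + none₃Σ e f g < 3 * t + (k + d) →
        Coverable (all₃Σ e f g + k + 3 * d)
      triple-cover e f g k d k≤ d≤ bound
        with u , u≤ , Σu ← distribute (λ j → 2 * two₃ (W e j) (W f j) (W g j)) k
                             (≤-trans k≤ (≤-reflexive (sym (Σ* 2 _))))
        with v , v≤ , Σv ← distribute (λ j → none₃ (W e j) (W f j) (W g j)) d d≤
        with cover-or-missed (λ j → remove-three (W e j) (W f j) (W g j) (u j) (v j) (u≤ j) (v≤ j))
      ... | inj₁ cover = weaken cover (≤-reflexive size)
        where
        size : sum (λ j → all₃ (W e j) (W f j) (W g j) + u j + 3 * v j) ≡ all₃Σ e f g + k + 3 * d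
        size = trans (Σ+ _ _) (cong₂ _+_ (trans (Σ+ _ u) (cong (all₃Σ e f g +_) Σu))
                                         (trans (Σ* 3 v) (cong (3 *_) Σv)))
      ... | inj₂ (h , missed) = contradiction bound (≤⇒≯ (begin
        3 * t + (k + d)
          ≡⟨ cong (_+ (k + d)) (lemma t) ⟩
        t + t + t + (k + d)
          ≤⟨ +-monoˡ-≤ _ (+-mono-≤ (+-mono-≤ (inter e h) (inter f h)) (inter g h)) ⟩
        agree (W e) (W h) + agree (W f) (W h) + agree (W g) (W h) + (k + d)
          ≡⟨ cong₂ _+_ weight (trans (Σ+ u v) (cong₂ _+_ Σu Σv)) ⟨
        sum (λ j → δ (W e j) (W h j) + δ (W f j) (W h j) + δ (W g j) (W h j))
        + sum (λ j → u j + v j)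
          ≡⟨ Σ+ _ _ ⟨
        sum (λ j → (δ (W e j) (W h j) + δ (W f j) (W h j) + δ (W g j) (W h j)) + (u j + v j))
          ≤⟨ sum-mono missed ⟩
        sum (λ j → 2 * two₃ (W e j) (W f j) (W g j) + none₃ (W e j) (W f j) (W g j))
          ≡⟨ trans (Σ+ _ _) (cong (_+ none₃Σ e f g) (Σ* 2 _)) ⟩
        2 * two₃Σ e f g + none₃Σ e f g ∎))
        where
        open ≤-Reasoning
        lemma : ∀ t → 3 * t ≡ t + t + t
        lemma t = solve (t ∷ [])
        weight : sum (λ j → δ (W e j) (W h j) + δ (W f j) (W h j) + δ (W g j) (W h j))
                 ≡ agree (W e) (W h) + agree (W f) (W h) + agree (W g) (W h)
        weight = trans (Σ+ _ _) (cong (_+ agree (W g) (W h)) (Σ+ (λ j → δ (W e j) (W h j)) _))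

      -- The missed word serves as `g`. It avoids the `l` vertices removed from `e` outside `f`, so
      -- `|e ∩ g|` is at most `|e ∩ f ∩ g| + r - |e ∩ f| - l`.
      third-edge : ∀ e f c l → c ≤ agree (W e) (W f) → l + agree (W e) (W f) ≤ r →
        Coverable (c + l) ⊎
        ∃ λ g → all₃Σ e f g + c ≤ agree (W e) (W f) ×
                agree (W e) (W g) + l + agree (W e) (W f) ≤ r + all₃Σ e f g
      third-edge e f c l c≤ l≤
        with u , u≤ , Σu ← distribute-agree (W e) (W f) c c≤
        with d , d≤ , Σd ← distribute-disagree (W e) (W f) l l≤
        with cover-or-missed (λ j → remove-towards-third (W e j) (W f j) (u j) (d j) (u≤ j) (d≤ j))
      ... | inj₁ cover = inj₁ (weaken cover (≤-reflexive (trans (Σ+ u d) (cong₂ _+_ Σu Σd))))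
      ... | inj₂ (g , missed) = inj₂ (g , common , off-f)
        where
        open ≤-Reasoning
        common : all₃Σ e f g + c ≤ agree (W e) (W f)
        common = begin
          all₃Σ e f g + c                                       ≡⟨ cong (all₃Σ e f g +_) Σu ⟨
          all₃Σ e f g + sum u                                   ≡⟨ Σ+ _ u ⟨
          sum (λ j → all₃ (W e j) (W f j) (W g j) + u j)        ≤⟨ sum-mono (proj₁ ∘ missed) ⟩
          agree (W e) (W f)                                     ∎
        off-f : agree (W e) (W g) + l + agree (W e) (W f) ≤ r + all₃Σ e f g
        off-f = begin
          agree (W e) (W g) + l + agree (W e) (W f)
            ≡⟨ cong (λ x → agree (W e) (W g) + x + agree (W e) (W f)) Σd ⟨
          agree (W e) (W g) + sum d + agree (W e) (W f)
            ≡⟨ cong (_+ agree (W e) (W f)) (Σ+ _ d) ⟨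
          sum (λ j → δ (W e j) (W g j) + d j) + agree (W e) (W f)
            ≡⟨ Σ+ _ _ ⟨
          sum (λ j → δ (W e j) (W g j) + d j + δ (W e j) (W f j))
            ≤⟨ sum-mono (proj₂ ∘ missed) ⟩
          sum (λ j → 1 + all₃ (W e j) (W f j) (W g j))
            ≡⟨ Σ1+ _ ⟩
          r + all₃Σ e f g ∎

      -- s, Y and D count the positions where e, f and g have one, two and three
      -- different vertices; p = |e ∩ g|, p′ = |f ∩ g|, and c + l vertices of e were
      -- removed to find g.
      module ThirdEdge
        {s Y D p p′ c q l τ : ℕ}
        (pair   : ∀ n k → n ≤ p′ → k + p′ ≤ r → p′ + r < 2 * t + 2 * n + k → Coverable (n + 2 * k))
        (triple : ∀ k d → k ≤ 2 * Y → d ≤ D → 2 * Y + D < 3 * t + (k + d) → Coverable (s + k + 3 * d))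
        (s+Y+D≡r : s + Y + D ≡ r) (pairs : t + p + p′ ≡ 3 * s + Y)
        (t≤p : t ≤ p) (t≤p′ : t ≤ p′) (p′≤r : p′ ≤ r)
        (common : s + c ≤ t) (off-f : p + l + t ≤ r + s)
        (1≤t : 1 ≤ t) (2t≤r : 2 * t ≤ r) (l+2t≡r+q : l + 2 * t ≡ r + q)
        (q-bound : 3 * r + 2 ≤ 5 * t + 3 * q + 2 * τ)
        (c-bound₂ : r + 1 ≤ c + τ + t)
        (c-bound₃ : 3 * r + 3 ≤ c + τ + 11 * t)
        where

        private
          s+Y+D≤r : s + Y + D ≤ r
          s+Y+D≤r = ≤-reflexive s+Y+D≡r

          pairs≤ : t + p + p′ ≤ 3 * s + Y
          pairs≤ = ≤-reflexive pairs

          pairs≥ : 3 * s + Y ≤ t + p + p′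
          pairs≥ = ≤-reflexive (sym pairs)

          r+q≤l+2t : r + q ≤ l + 2 * t
          r+q≤l+2t = ≤-reflexive (sym l+2t≡r+q)

          s≤τ : s + 0 + 0 ≤ τ
          s≤τ = ≤-by (common ⊕ 2t≤r ⊕ c-bound₂ ⊕ z≤n {1}) (solve (r ∷ t ∷ τ ∷ c ∷ s ∷ []))

          -- The pair count and `t ≤ p` give `p′ ≤ 2s + r - 2t`; then `s ≤ t - c` and the lower
          -- bound on `c` apply.
          p′+r≤ : p′ + r + 2 ≤ 2 * t + 2 * τ
          p′+r≤ = ≤-by (2 ⊗ common ⊕ s+Y+D≤r ⊕ pairs≤ ⊕ t≤p ⊕ 2 ⊗ c-bound₂ ⊕ z≤n {D})
                       (solve (r ∷ t ∷ τ ∷ c ∷ s ∷ Y ∷ D ∷ p ∷ p′ ∷ []))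

        two-words-short : r < p′ + 2 * t → Coverable τ
        two-words-short r< with τ ≤? p′
        ... | yes τ≤p′ = weaken (pair τ 0 τ≤p′ p′≤r
                (≤-by (p′+r≤ ⊕ z≤n {1}) (solve (r ∷ t ∷ τ ∷ p′ ∷ [])))) (≤-reflexive (+-identityʳ τ))
        ... | no τ≰p′ = weaken (pair p′ 0 ≤-refl p′≤r (≤-by r< (solve (r ∷ t ∷ p′ ∷ []))))
                (≤-trans (≤-reflexive (+-identityʳ p′)) (≰⇒≥ τ≰p′))

        -- Once all of `f ∩ g` is removed, this `k` is the least number of further positions that
        -- closes the count.
        two-words-long : ∀ k → k + (p′ + 2 * t) ≡ r + 1 → p′ + 2 * k ≤ τ → Coverable τ
        two-words-long k k-def size = weaken (pair p′ k ≤-refl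
          (≤-by (≤-reflexive k-def ⊕ 1≤t ⊕ z≤n {t}) (solve (k ∷ p′ ∷ t ∷ r ∷ [])))
          (≤-by (≤-reflexive (sym k-def)) (solve (k ∷ p′ ∷ t ∷ r ∷ [])))) size

        three-words-few : τ + 4 * t + p′ + 1 ≤ 2 * r + 2 → D < 3 * t → Coverable τ
        three-words-few p′≤ D<3t with 3 * t ≤? 2 * Y + D + 1
        ... | no 3t≰ = weaken (triple 0 0 z≤n z≤n
                (≤-by (≰⇒> 3t≰ ⊕ z≤n {1}) (solve (Y ∷ D ∷ t ∷ [])))) s≤τ
        -- With no triples removed, this is the least number of vertices that closes the count;
        -- `D < 3t` keeps it at most `2Y`.
        ... | yes 3t≤ = via ((2 * Y + D + 1) ∸ 3 * t) (m∸n+n≡m 3t≤)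
          where
          via : ∀ k → k + 3 * t ≡ 2 * Y + D + 1 → Coverable τ
          via k k-def = weaken
            (triple k 0
              (≤-by (≤-reflexive k-def ⊕ D<3t) (solve (k ∷ Y ∷ D ∷ t ∷ []))) z≤n
              (≤-by (≤-reflexive (sym k-def)) (solve (k ∷ Y ∷ D ∷ t ∷ []))))
            size
            where
            size : s + k + 0 ≤ τ
            -- `off-f` says `p ≤ t + s - q`, hence also `q ≤ s` by `t ≤ p`. With `pairs≥` this gives
            -- `Y ≤ p′ + 2t - 3q`, while `s + k ≤ r + Y + 1 - 3t`.
            size = ≤-by (≤-reflexive k-def ⊕ 3 ⊗ off-f ⊕ s+Y+D≤r ⊕ pairs≥ ⊕ 2 ⊗ t≤p
                          ⊕ 3 ⊗ r+q≤l+2t ⊕ p′≤ ⊕ q-bound)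
                        (solve (r ∷ t ∷ τ ∷ q ∷ l ∷ s ∷ Y ∷ D ∷ p ∷ p′ ∷ k ∷ []))

        three-words-many : 3 * t ≤ D → Coverable τ
        three-words-many 3t≤D = via ((D + 1) ∸ 3 * t) (m∸n+n≡m (≤-trans 3t≤D (m≤m+n D 1)))
          where
          via : ∀ d → d + 3 * t ≡ D + 1 → Coverable τ
          via d d-def = weaken
            (triple (2 * Y) d ≤-refl
              (≤-by (≤-reflexive d-def ⊕ 1≤t ⊕ z≤n {2 * t}) (solve (d ∷ t ∷ D ∷ [])))
              (≤-by (≤-reflexive (sym d-def)) (solve (d ∷ t ∷ D ∷ Y ∷ []))))
            size
            where
            size : s + 2 * Y + 3 * d ≤ τ
            size = ≤-by (3 ⊗ ≤-reflexive d-def ⊕ common ⊕ 3 ⊗ s+Y+D≤r ⊕ pairs≤ ⊕ t≤p ⊕ t≤p′ ⊕ c-bound₃)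
                        (solve (r ∷ t ∷ τ ∷ c ∷ s ∷ Y ∷ D ∷ p ∷ p′ ∷ d ∷ []))

        three-words : τ + 4 * t + p′ + 1 ≤ 2 * r + 2 → Coverable τ
        three-words p′≤ with D <? 3 * t
        ... | yes D<3t = three-words-few p′≤ D<3t
        ... | no D≮3t  = three-words-many (≮⇒≥ D≮3t)

        cover : Coverable τ
        cover with p′ + 2 * t ≤? r
        ... | no p′+2t≰r = two-words-short (≰⇒> p′+2t≰r)
        ... | yes p′+2t≤r = via ((r + 1) ∸ (p′ + 2 * t)) (m∸n+n≡m (≤-trans p′+2t≤r (m≤m+n r 1)))
          where
          via : ∀ k → k + (p′ + 2 * t) ≡ r + 1 → Coverable τ
          via k k-def with p′ + 2 * k ≤? τ
          ... | yes size = two-words-long k k-def size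
          -- The two-word cover has size `p′ + 2k = 2r + 2 - 4t - p′`, so its failure bounds `p′`
          -- from above.
          ... | no large = three-words
                (≤-by (2 ⊗ ≤-reflexive k-def ⊕ ≰⇒> large) (solve (k ∷ p′ ∷ t ∷ r ∷ τ ∷ [])))

      -- `c ≤ t` and `q ≤ t` guarantee that `e` has `c` vertices in `f` and `l` outside it. The last
      -- three inequalities keep every cover built from `g` within `τ`.
      three-edge-cover : ∀ {τ} e f c q l → agree (W e) (W f) ≡ t → 1 ≤ t → 2 * t ≤ r →
        l + 2 * t ≡ r + q → c + l ≤ τ → q ≤ t → c ≤ t →
        3 * r + 2 ≤ 5 * t + 3 * q + 2 * τ →
        r + 1 ≤ c + τ + t →
        3 * r + 3 ≤ c + τ + 11 * t →
        Coverable τ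
      three-edge-cover {τ} e f c q l ef≡t 1≤t 2t≤r l≡ c+l≤τ q≤t c≤t q-bound c-bound₂ c-bound₃
        with third-edge e f c l (≤-trans c≤t (≤-reflexive (sym ef≡t)))
               (≤-trans (≤-reflexive (cong (l +_) ef≡t)) l≤)
        where
        l≤ : l + t ≤ r
        l≤ = ≤-by (≤-reflexive l≡ ⊕ q≤t) (solve (l ∷ t ∷ r ∷ q ∷ []))
      ... | inj₁ cover = weaken cover c+l≤τ
      ... | inj₂ (g , common , off-f) = ThirdEdge.cover
        (pair-cover f g) (triple-cover e f g) (partitionΣ e f g)
        (subst (λ x → x + agree (W e) (W g) + agree (W f) (W g) ≡ 3 * all₃Σ e f g + two₃Σ e f g)
               ef≡t (pairsΣ e f g))
        (inter e g) (inter f g)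
        (m+n≤o⇒m≤o (agree (W f) (W g)) (≤-reflexive (agree-complement (W f) (W g))))
        (≤-trans common (≤-reflexive ef≡t))
        (subst (λ x → agree (W e) (W g) + l + x ≤ r + all₃Σ e f g) ef≡t off-f)
        1≤t 2t≤r l≡ q-bound c-bound₂ c-bound₃

      -- Covers from a pair that attains the least agreement.

      module Attained (e f : Fin N) (ef≡t : agree (W e) (W f) ≡ t) (1≤t : 1 ≤ t) where

        private
          t≤r : t ≤ r
          t≤r = m+n≤o⇒m≤o t (≤-reflexive
                  (subst (λ x → x + sum (λ j → 1 ∸ δ (W e j) (W f j)) ≡ r) ef≡t
                         (agree-complement (W e) (W f))))

          pair : ∀ n k → n ≤ t → k + t ≤ r → t + r < 2 * t + 2 * n + k → Coverable (n + 2 * k)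
          pair n k = subst (λ x → n ≤ x → k + x ≤ r → x + r < 2 * t + 2 * n + k → Coverable (n + 2 * k))
                           ef≡t (pair-cover e f n k)

        cover-by-one : ∀ {b} → r < t + b → Coverable b
        cover-by-one {b} r<t+b with b ≤? r
        ... | yes b≤r = single-cover e b b≤r r<t+b
        ... | no b≰r  = weaken (single-cover e r ≤-refl (+-monoˡ-≤ r 1≤t)) (≰⇒≥ b≰r)

        cover-by-common : ∀ {b} → r < 3 * t → r < t + 2 * b → Coverable b
        cover-by-common {b} r<3t r<t+2b with b ≤? t
        ... | yes b≤t = weaken (pair b 0 b≤t t≤r (≤-by r<t+2b (solve (r ∷ t ∷ b ∷ []))))
                               (≤-reflexive (+-identityʳ b))
        ... | no b≰t  = weaken (pair t 0 ≤-refl t≤r (≤-by r<3t (solve (r ∷ t ∷ []))))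
                               (≤-trans (≤-reflexive (+-identityʳ t)) (≰⇒≥ b≰t))

        cover-by-two : ∀ {b} → 3 * t ≤ r → 2 * r + 2 ≤ 5 * t + b → Coverable b
        -- `k = r + 1 - 3t` is the least value that closes the count, and `t + 2k = 2r + 2 - 5t`.
        cover-by-two {b} 3t≤r bound = via ((r + 1) ∸ 3 * t) (m∸n+n≡m (≤-trans 3t≤r (m≤m+n r 1)))
          where
          via : ∀ k → k + 3 * t ≡ r + 1 → Coverable b
          via k k-def = weaken
            (pair t k ≤-refl
              (≤-by (≤-reflexive k-def ⊕ 1≤t ⊕ z≤n {t}) (solve (k ∷ t ∷ r ∷ [])))
              (≤-by (≤-reflexive (sym k-def)) (solve (k ∷ t ∷ r ∷ []))))
            size
            where
            size : t + 2 * k ≤ b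
            size = ≤-by (2 ⊗ ≤-reflexive k-def ⊕ bound) (solve (k ∷ t ∷ r ∷ b ∷ []))

        cover-by-three : ∀ b c q → c ≤ t → q ≤ t → 2 * t ≤ r → c + q + r ≤ b + 2 * t →
          3 * r + 2 ≤ 5 * t + 3 * q + 2 * b →
          r + 1 ≤ c + b + t →
          3 * r + 3 ≤ c + b + 11 * t →
          Coverable b
        cover-by-three b c q c≤t q≤t 2t≤r size =
          three-edge-cover e f c q l ef≡t 1≤t 2t≤r l-def (c+l≤b l (≤-reflexive l-def)) q≤t c≤t
          where
          l : ℕ
          l = (r + q) ∸ 2 * t
          l-def : l + 2 * t ≡ r + q
          l-def = m∸n+n≡m (≤-trans 2t≤r (m≤m+n r q))
          c+l≤b : ∀ l → l + 2 * t ≤ r + q → c + l ≤ b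
          c+l≤b l h = ≤-by (h ⊕ size) (solve (c ∷ q ∷ r ∷ b ∷ t ∷ l ∷ []))

        -- Here c is the least value meeting the last but one condition of cover-by-three,
        -- and q exhausts the budget b; in cover-huge, c comes from the last condition.
        cover-large : ∀ {b} → 3 * t ≤ r → r + 2 ≤ 5 * t → 9 * r + 9 ≤ 14 * t + 8 * b → Coverable b
        cover-large {b} 3t≤r r+2≤5t bound with t + b ≤? r
        ... | no t+b≰r  = cover-by-one (≰⇒> t+b≰r)
        ... | yes t+b≤r = via (r + 1 ∸ (t + b)) (2 * b + 3 * t ∸ (2 * r + 1))
                              (m∸n+n≡m (≤-trans t+b≤r (m≤m+n r 1))) (m∸n+n≡m q-exists)
          where
          q-exists : 2 * r + 1 ≤ 2 * b + 3 * t
          q-exists = *-cancelˡ-≤ 4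
            (≤-by (bound ⊕ 3t≤r ⊕ z≤n {5 + t}) (solve (r ∷ t ∷ b ∷ [])))
          via : ∀ c q → c + (t + b) ≡ r + 1 → q + (2 * r + 1) ≡ 2 * b + 3 * t → Coverable b
          via c q c-def q-def = cover-by-three b c q
            (*-cancelˡ-≤ 8 (≤-by (8 ⊗ c≤ ⊕ bound ⊕ z≤n {r + 1 + 2 * t}) (solve (r ∷ t ∷ b ∷ c ∷ []))))
            (≤-by (q≤ ⊕ 2 ⊗ t+b≤r ⊕ z≤n {1}) (solve (r ∷ t ∷ b ∷ q ∷ [])))
            (≤-by (3t≤r ⊕ z≤n {t}) (solve (r ∷ t ∷ [])))
            (≤-by (c≤ ⊕ q≤) (solve (r ∷ t ∷ b ∷ c ∷ q ∷ [])))
            -- Substituting `q` reduces this to `9r + 5 ≤ 14t + 8b`, the origin of the coefficients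
            -- 9, 14 and 8.
            (≤-by (bound ⊕ 3 ⊗ q≥ ⊕ z≤n {4}) (solve (r ∷ t ∷ b ∷ q ∷ [])))
            (≤-by c≥ (solve (r ∷ t ∷ b ∷ c ∷ [])))
            (≤-by (c≥ ⊕ 2 ⊗ r+2≤5t ⊕ z≤n {2}) (solve (r ∷ t ∷ b ∷ c ∷ [])))
            where
            c≤ : c + (t + b) ≤ r + 1
            c≤ = ≤-reflexive c-def
            c≥ : r + 1 ≤ c + (t + b)
            c≥ = ≤-reflexive (sym c-def)
            q≤ : q + (2 * r + 1) ≤ 2 * b + 3 * t
            q≤ = ≤-reflexive q-def
            q≥ : 2 * b + 3 * t ≤ q + (2 * r + 1)
            q≥ = ≤-reflexive (sym q-def)

        -- The two lower bounds on `c` differ by `2r + 2 - 10t`, so for `5t ≤ r + 1` the one from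
        -- `three-words-many` dominates.
        cover-huge : ∀ {b} → 5 * t ≤ r + 1 → 9 * r + 13 ≤ 52 * t → 15 * r + 17 ≤ 44 * t + 8 * b →
                     Coverable b
        cover-huge {b} 5t≤r+1 r≤ bound with t + b ≤? r
        ... | no t+b≰r  = cover-by-one (≰⇒> t+b≰r)
        ... | yes t+b≤r = via (3 * r + 3 ∸ (11 * t + b)) (2 * b + 13 * t ∸ (4 * r + 3))
                              (m∸n+n≡m c-exists) (m∸n+n≡m q-exists)
          where
          c-exists : 11 * t + b ≤ 3 * r + 3
          c-exists = ≤-by (t+b≤r ⊕ 2 ⊗ 5t≤r+1 ⊕ z≤n {1}) (solve (r ∷ t ∷ b ∷ []))
          q-exists : 4 * r + 3 ≤ 2 * b + 13 * t
          q-exists = *-cancelˡ-≤ 36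
            (≤-by (9 ⊗ bound ⊕ r≤ ⊕ z≤n {58 + 20 * t}) (solve (r ∷ t ∷ b ∷ [])))
          via : ∀ c q → c + (11 * t + b) ≡ 3 * r + 3 → q + (4 * r + 3) ≡ 2 * b + 13 * t → Coverable b
          via c q c-def q-def = cover-by-three b c q
            -- Here `8c ≤ 9r + 7 - 44t`, so the upper end of the range of `r` keeps `c` within `t`.
            (*-cancelˡ-≤ 8 (≤-by (8 ⊗ c≤ ⊕ bound ⊕ r≤ ⊕ z≤n {6}) (solve (r ∷ t ∷ b ∷ c ∷ []))))
            (≤-by (q≤ ⊕ 2 ⊗ t+b≤r ⊕ 2 ⊗ 5t≤r+1 ⊕ z≤n {1}) (solve (r ∷ t ∷ b ∷ q ∷ [])))
            (≤-by (5t≤r+1 ⊕ 1≤t ⊕ z≤n {2 * t}) (solve (r ∷ t ∷ [])))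
            (≤-by (c≤ ⊕ q≤) (solve (r ∷ t ∷ b ∷ c ∷ q ∷ [])))
            (≤-by (bound ⊕ 3 ⊗ q≥ ⊕ z≤n {6}) (solve (r ∷ t ∷ b ∷ q ∷ [])))
            (≤-by (c≥ ⊕ 2 ⊗ 5t≤r+1) (solve (r ∷ t ∷ b ∷ c ∷ [])))
            (≤-by c≥ (solve (r ∷ t ∷ b ∷ c ∷ [])))
            where
            c≤ : c + (11 * t + b) ≤ 3 * r + 3
            c≤ = ≤-reflexive c-def
            c≥ : 3 * r + 3 ≤ c + (11 * t + b)
            c≥ = ≤-reflexive (sym c-def)
            q≤ : q + (4 * r + 3) ≤ 2 * b + 13 * t
            q≤ = ≤-reflexive q-def
            q≥ : 2 * b + 13 * t ≤ q + (4 * r + 3)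
            q≥ = ≤-reflexive (sym q-def)

-- Edges of a partite hypergraph, class by class.

sum-indicator : ∀ {r} (i : Fin r) → sum (λ j → if ⌊ i Fin.≟ j ⌋ then 1 else 0) ≡ 1
sum-indicator i = trans (sum-cong-≗ (λ j → cong (if_then 1 else 0) (isYes≗does (i Fin.≟ j)))) (go i)
  where
  go : ∀ {r} (i : Fin r) → sum (λ j → if does (i Fin.≟ j) then 1 else 0) ≡ 1
  go {suc r} zero    = cong suc (sum-0 r)
  go {suc r} (suc i) = go i

∣∷∣ : ∀ {n} b (p : Subset n) → ∣ b Vec.∷ p ∣ ≡ (if b then 1 else 0) + ∣ p ∣
∣∷∣ true  p = refl
∣∷∣ false p = refl

∣p∣≡Σ∣p∩class∣ : ∀ {n r} (part : Fin n → Fin r) (p : Subset n) →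
                 ∣ p ∣ ≡ sum (λ j → ∣ p ∩ classOf part j ∣)
∣p∣≡Σ∣p∩class∣ {r = r} part Vec.[]            = sym (sum-0 r)
∣p∣≡Σ∣p∩class∣         part (outside Vec.∷ p) = ∣p∣≡Σ∣p∩class∣ (part ∘ suc) p
∣p∣≡Σ∣p∩class∣ {r = r} part (inside Vec.∷ p)  = begin
  suc ∣ p ∣
    ≡⟨ cong₂ _+_ (sym (sum-indicator (part zero))) (∣p∣≡Σ∣p∩class∣ (part ∘ suc) p) ⟩
  sum (λ j → if ⌊ part zero Fin.≟ j ⌋ then 1 else 0) + sum (λ j → ∣ p ∩ classOf (part ∘ suc) j ∣)
    ≡⟨ ∑-distrib-+ {r} _ _ ⟨
  sum (λ j → (if ⌊ part zero Fin.≟ j ⌋ then 1 else 0) + ∣ p ∩ classOf (part ∘ suc) j ∣)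
    ≡⟨ sum-cong-≗ (λ j → ∣∷∣ ⌊ part zero Fin.≟ j ⌋ (p ∩ classOf (part ∘ suc) j)) ⟨
  sum (λ j → ∣ (inside Vec.∷ p) ∩ classOf part j ∣) ∎
  where open ≡-Reasoning

module _ {n : ℕ} (p : Subset n) (∣p∣≡1 : ∣ p ∣ ≡ 1) where

  element : ∃ λ x → x ∈ˢ p
  element with nonempty? p
  ... | yes x∈p = x∈p
  ... | no ∅p   = contradiction (trans (sym ∣p∣≡1) (trans (cong ∣_∣ (Empty-unique ∅p)) (∣⊥∣≡0 n))) λ ()

  singleton-unique : ∀ {x y} → x ∈ˢ p → y ∈ˢ p → x ≡ y
  singleton-unique {x} {y} x∈p y∈p with x Fin.≟ y
  ... | yes x≡y = x≡y
  -- Removing `y` and then `x` would lower the size 1 twice.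
  ... | no x≢y  = contradiction
    (<-≤-trans (x∈p⇒∣p-x∣<∣p∣ (x∈p∧x≢y⇒x∈p-y x∈p x≢y))
      (s≤s⁻¹ (≤-trans (x∈p⇒∣p-x∣<∣p∣ y∈p) (≤-reflexive ∣p∣≡1))))
    λ ()

open Words

-- A common vertex in the class would be the unique vertex of both edges there. This direction
-- carries the lower bound on intersections over to agreements.
∣p∩q∣≤δ : ∀ {n} (p q c : Subset n) (p₁ : ∣ p ∩ c ∣ ≡ 1) (q₁ : ∣ q ∩ c ∣ ≡ 1) →
          ∣ (p ∩ q) ∩ c ∣ ≤ δ Fin._≟_ (proj₁ (element (p ∩ c) p₁)) (proj₁ (element (q ∩ c) q₁))
∣p∩q∣≤δ {n} p q c p₁ q₁ with proj₁ (element (p ∩ c) p₁) Fin.≟ proj₁ (element (q ∩ c) q₁)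
... | yes _ = ≤-trans (p⊆q⇒∣p∣≤∣q∣ ⊆p∩c) (≤-reflexive p₁)
  where
  ⊆p∩c : (p ∩ q) ∩ c ⊆ p ∩ c
  ⊆p∩c x∈ with x∈pq , x∈c ← x∈p∩q⁻ (p ∩ q) c x∈ = x∈p∩q⁺ (proj₁ (x∈p∩q⁻ p q x∈pq) , x∈c)
... | no x≢y with nonempty? ((p ∩ q) ∩ c)
...   | no ∅pq = ≤-reflexive (trans (cong ∣_∣ (Empty-unique ∅pq)) (∣⊥∣≡0 n))
...   | yes (z , z∈) with z∈pq , z∈c ← x∈p∩q⁻ (p ∩ q) c z∈
  with z∈p , z∈q ← x∈p∩q⁻ p q z∈pq
  = contradiction (trans (singleton-unique (p ∩ c) p₁ (proj₂ (element (p ∩ c) p₁)) (x∈p∩q⁺ (z∈p , z∈c)))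
                         (singleton-unique (q ∩ c) q₁ (x∈p∩q⁺ (z∈q , z∈c)) (proj₂ (element (q ∩ c) q₁)))) x≢y

-- Vertex sets from lists chosen at each position.

length-concat-tabulate : ∀ {A : Set} {r} (C : Fin r → List A) →
                         length (concat (tabulate C)) ≡ sum (λ j → length (C j))
length-concat-tabulate {r = zero}  C = refl
length-concat-tabulate {r = suc r} C =
  trans (length-++ (C zero)) (cong (length (C zero) +_) (length-concat-tabulate (C ∘ suc)))

fromList : ∀ {n} → List (Fin n) → Subset n
fromList []       = ∅
fromList (x ∷ xs) = ⁅ x ⁆ ∪ fromList xs

∈-fromList : ∀ {n} {x : Fin n} {xs} → x ∈ xs → x ∈ˢ fromList xs
∈-fromList {xs = y ∷ xs} (here refl) = x∈p∪q⁺ (inj₁ (x∈⁅x⁆ y))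
∈-fromList (there x∈)  = x∈p∪q⁺ (inj₂ (∈-fromList x∈))

∣p∪q∣≤∣p∣+∣q∣ : ∀ {n} (p q : Subset n) → ∣ p ∪ q ∣ ≤ ∣ p ∣ + ∣ q ∣
∣p∪q∣≤∣p∣+∣q∣ Vec.[]            Vec.[]         = z≤n
∣p∪q∣≤∣p∣+∣q∣ (outside Vec.∷ p) (outside Vec.∷ q) = ∣p∪q∣≤∣p∣+∣q∣ p q
∣p∪q∣≤∣p∣+∣q∣ (outside Vec.∷ p) (inside Vec.∷ q)  =
  ≤-trans (s≤s (∣p∪q∣≤∣p∣+∣q∣ p q)) (≤-reflexive (sym (+-suc ∣ p ∣ ∣ q ∣)))
∣p∪q∣≤∣p∣+∣q∣ (inside Vec.∷ p)  (outside Vec.∷ q) = s≤s (∣p∪q∣≤∣p∣+∣q∣ p q)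
∣p∪q∣≤∣p∣+∣q∣ (inside Vec.∷ p)  (inside Vec.∷ q)  =
  s≤s (≤-trans (∣p∪q∣≤∣p∣+∣q∣ p q) (+-monoʳ-≤ ∣ p ∣ (n≤1+n ∣ q ∣)))

∣fromList∣≤ : ∀ {n} (xs : List (Fin n)) → ∣ fromList xs ∣ ≤ length xs
∣fromList∣≤ {n} []   = ≤-reflexive (∣⊥∣≡0 n)
∣fromList∣≤ (x ∷ xs) = ≤-trans (∣p∪q∣≤∣p∣+∣q∣ ⁅ x ⁆ (fromList xs))
                               (+-mono-≤ (≤-reflexive (∣⁅x⁆∣≡1 x)) (∣fromList∣≤ xs))

-- Choice of a construction for the least agreement.

closest-pair : ∀ {N} (g : Fin (suc N) → Fin (suc N) → ℕ) → ∃ λ i → ∃ λ k → ∀ i′ k′ → g i k ≤ g i′ k′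
closest-pair g with i , i-min ← argmin (λ i → g i (proj₁ (argmin (g i))))
  = i , proj₁ (argmin (g i)) , λ i′ k′ → ≤-trans (i-min i′) (proj₂ (argmin (g i′)) k′)

-- Each constructor holds the hypotheses of one cover construction with budget `b`, where `m` is the
-- least agreement.
data Sufficient (r m b : ℕ) : Set where
  common : r < 3 * m → r < m + 2 * b → Sufficient r m b
  two    : 3 * m ≤ r → 2 * r + 2 ≤ 5 * m + b → Sufficient r m b
  large  : 3 * m ≤ r → r + 2 ≤ 5 * m → 9 * r + 9 ≤ 14 * m + 8 * b → Sufficient r m b
  huge   : 5 * m ≤ r + 1 → 9 * r + 13 ≤ 52 * m → 15 * r + 17 ≤ 44 * m + 8 * b → Sufficient r m b

coverable : ∀ {V : Set} (_≟ᵛ_ : DecidableEquality V) {N r t b} (W : Fin N → Fin r → V) → 1 ≤ t →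
  (∀ i k → t ≤ agree _≟ᵛ_ (W i) (W k)) → (∀ m → t ≤ m → Sufficient r m b) →
  Family.Coverable _≟ᵛ_ W b
coverable _≟ᵛ_ {zero} {r} W 1≤t inter sufficient =
  (λ _ → []) , ≤-trans (≤-reflexive (sum-0 r)) z≤n , λ ()
coverable _≟ᵛ_ {suc N} {r} {t} {b} W 1≤t inter sufficient
  with e , f , minimal ← closest-pair (λ i k → agree _≟ᵛ_ (W i) (W k))
  = bound (sufficient m (inter e f))
  where
  m : ℕ
  m = agree _≟ᵛ_ (W e) (W f)
  open Family _≟ᵛ_ W
  -- The least agreement `m ≥ t` takes the place of `t`, so that `e` and `f` attain the bound
  -- exactly.
  open PairwiseAgree m minimal
  open Attained e f refl (≤-trans 1≤t (inter e f))
  bound : Sufficient r m b → Coverable b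
  bound (common p q)  = cover-by-common p q
  bound (two p q)     = cover-by-two p q
  bound (large p q s) = cover-large p q s
  bound (huge p q s)  = cover-huge p q s

-- Passage between hypergraphs and words.

module _ {r t : ℕ} {H : Hypergraph} (rt : RTGraph r t H) where

  private
    part : Fin (n H) → Fin r
    part = proj₁ (proj₁ (proj₂ rt))

    edge : Fin (length (edges H)) → Subset (n H)
    edge = lookup (edges H)

    meets-class : ∀ i j → ∣ edge i ∩ classOf part j ∣ ≡ 1
    meets-class i = proj₂ (proj₁ (proj₂ rt)) (edge i) (∈-lookup i)

  word : Fin (length (edges H)) → Fin r → Fin (n H)
  word i j = proj₁ (element (edge i ∩ classOf part j) (meets-class i j))

  word∈edge : ∀ i j → word i j ∈ˢ edge i
  word∈edge i j = proj₁ (x∈p∩q⁻ (edge i) (classOf part j)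
                          (proj₂ (element (edge i ∩ classOf part j) (meets-class i j))))

  words-agree : ∀ i k → t ≤ agree Fin._≟_ (word i) (word k)
  words-agree i k = begin
    t
      ≤⟨ proj₂ (proj₂ rt) (edge i) (edge k) (∈-lookup i) (∈-lookup k) ⟩
    ∣ edge i ∩ edge k ∣
      ≡⟨ ∣p∣≡Σ∣p∩class∣ part (edge i ∩ edge k) ⟩
    sum (λ j → ∣ (edge i ∩ edge k) ∩ classOf part j ∣)
      ≤⟨ sum-mono (λ j → ∣p∩q∣≤δ (edge i) (edge k) (classOf part j)
                           (meets-class i j) (meets-class k j)) ⟩
    agree Fin._≟_ (word i) (word k) ∎
    where open ≤-Reasoning

  cover-number : ∀ {b} → Family.Coverable Fin._≟_ word b → CoverNumberAtMost H b
  cover-number (C , size , covers) = fromList vertices , covering , (begin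
    ∣ fromList vertices ∣          ≤⟨ ∣fromList∣≤ vertices ⟩
    length vertices                ≡⟨ length-concat-tabulate C ⟩
    sum (λ j → length (C j))       ≤⟨ size ⟩
    _                              ∎)
    where
    open ≤-Reasoning
    vertices : List (Fin (n H))
    vertices = concat (tabulate C)
    covering : IsCover H (fromList vertices)
    covering e e∈ with j , hit ← covers (index e∈)
      = word (index e∈) j
      , x∈p∩q⁺ ( ∈-fromList (∈-concat⁺′ hit (∈-tabulate⁺ j))
               , subst (word (index e∈) j ∈ˢ_) (sym (lookup-index e∈)) (word∈edge (index e∈) j))

bounded : ∀ {r t b} → 1 ≤ t → (∀ m → t ≤ m → Sufficient r m b) → RAtMost r t b
bounded 1≤t sufficient H rt =
  cover-number {H = H} rt
    (coverable Fin._≟_ (word {H = H} rt) 1≤t (words-agree {H = H} rt) sufficient)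

-- Arithmetic of the four ranges of `r`.

sufficient₁ : ∀ r t b m → r + 1 ≤ 3 * t → r + 1 ≤ t + 2 * b → t ≤ m → Sufficient r m b
sufficient₁ r t b m r≤ bound t≤m = common
  (≤-by (r≤ ⊕ 3 ⊗ t≤m) (solve (r ∷ t ∷ m ∷ [])))
  (≤-by (bound ⊕ t≤m) (solve (r ∷ t ∷ b ∷ m ∷ [])))

-- `m` may be so large that `r < 3m`. Then `b ≥ 2r + 2 - 5t` and `3t ≤ r` give `3b ≥ r + 6`, hence
-- `r < m + 2b`.
sufficient₂ : ∀ r t b m → 3 * t ≤ r → 2 * r + 2 ≤ 5 * t + b → t ≤ m → Sufficient r m b
sufficient₂ r t b m 3t≤r bound t≤m with 3 * m ≤? r
... | no 3m≰r  = common (≰⇒> 3m≰r) (*-cancelˡ-≤ 3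
  (≤-by (≰⇒> 3m≰r ⊕ 6 ⊗ bound ⊕ 10 ⊗ 3t≤r ⊕ z≤n {10}) (solve (r ∷ t ∷ b ∷ m ∷ []))))
... | yes 3m≤r = two 3m≤r (≤-by (bound ⊕ 5 ⊗ t≤m) (solve (r ∷ t ∷ b ∷ m ∷ [])))

sufficient₃ : ∀ r t b m → 26 * t ≤ 7 * r → r + 2 ≤ 5 * t → 9 * r + 9 ≤ 14 * t + 8 * b →
              t ≤ m → Sufficient r m b
sufficient₃ r t b m r≥ r≤ bound t≤m with 3 * m ≤? r
-- `26t ≤ 7r` makes the budget so large that already `r < 2b`.
... | no 3m≰r  = common (≰⇒> 3m≰r) (*-cancelˡ-≤ 52
  (≤-by (13 ⊗ bound ⊕ 7 ⊗ r≥ ⊕ z≤n {65 + 16 * r + 52 * m}) (solve (r ∷ t ∷ b ∷ m ∷ []))))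
... | yes 3m≤r = large 3m≤r
  (≤-by (r≤ ⊕ 5 ⊗ t≤m) (solve (r ∷ t ∷ m ∷ [])))
  (≤-by (bound ⊕ 14 ⊗ t≤m) (solve (r ∷ t ∷ b ∷ m ∷ [])))

-- As `m` grows past `t`, the value `r` may leave the range `5m ≤ r + 1` for `3m ≤ r < 5m - 1` or
-- for `r < 3m`, and the budget set by `t` has to suffice in each.
sufficient₄ : ∀ r t b m → 5 * t ≤ r + 1 → 9 * r + 13 ≤ 52 * t → 15 * r + 17 ≤ 44 * t + 8 * b →
              t ≤ m → Sufficient r m b
sufficient₄ r t b m r≥ r≤ bound t≤m with 3 * m ≤? r | 5 * m ≤? r + 1
... | no 3m≰r  | _ = common (≰⇒> 3m≰r) (*-cancelˡ-≤ 20
  (≤-by (5 ⊗ bound ⊕ 44 ⊗ r≥ ⊕ z≤n {21 + 11 * r + 20 * m}) (solve (r ∷ t ∷ b ∷ m ∷ []))))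
... | yes _    | yes 5m≤r+1 = huge 5m≤r+1
  (≤-by (r≤ ⊕ 52 ⊗ t≤m) (solve (r ∷ t ∷ m ∷ [])))
  (≤-by (bound ⊕ 44 ⊗ t≤m) (solve (r ∷ t ∷ b ∷ m ∷ [])))
... | yes 3m≤r | no 5m≰r+1 = large 3m≤r r+2≤5m (*-cancelˡ-≤ 5
  (≤-by (5 ⊗ bound ⊕ 44 ⊗ r≥ ⊕ 14 ⊗ r+2≤5m ⊕ z≤n {24}) (solve (r ∷ t ∷ b ∷ m ∷ []))))
  where
  r+2≤5m : r + 2 ≤ 5 * m
  r+2≤5m = ≤-by (≰⇒> 5m≰r+1) (solve (r ∷ m ∷ []))

-- `n ≤ o + (n ∸ o)` holds even for `n < o`, and the remainder modulo `k` is less than `k`.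
floor-bound : ∀ n o k .{{_ : NonZero k}} → n < o + (k + (n ∸ o) / k * k)
floor-bound n o k = ≤-<-trans (m≤n+m∸n n o) (+-monoʳ-< o (begin-strict
  n ∸ o                            ≡⟨ m≡m%n+[m/n]*n (n ∸ o) k ⟩
  (n ∸ o) % k + (n ∸ o) / k * k    <⟨ +-monoˡ-< _ (m%n<n (n ∸ o) k) ⟩
  k + (n ∸ o) / k * k              ∎))
  where open ≤-Reasoning

theorem1p5 : ∀ (r t : ℕ) → 1 ≤ t → t ≤ r →
    ((r ≤ 3 * t ∸ 1) → RAtMost r t ((r ∸ t) / 2 + 1)) ×
    ((3 * t ≤ r) → (7 * r ≤ 26 * t) → RAtMost r t (2 * r + 2 ∸ 5 * t)) ×
    ((26 * t ≤ 7 * r) → (r ≤ 5 * t ∸ 2) → RAtMost r t ((9 * r ∸ 14 * t) / 8 + 2)) ×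
    ((5 * t ∸ 1 ≤ r) → (9 * r ≤ 52 * t ∸ 13) → RAtMost r t ((15 * r ∸ 44 * t) / 8 + 3))
theorem1p5 r t 1≤t _ = case₁ , case₂ , case₃ , case₄
  where
  case₁ : r ≤ 3 * t ∸ 1 → RAtMost r t ((r ∸ t) / 2 + 1)
  case₁ r≤ = bounded 1≤t λ m → sufficient₁ r t _ m
    (m≤o∸n⇒m+n≤o r (≤-trans 1≤t (m≤n*m t 3)) r≤)
    (size ((r ∸ t) / 2) (floor-bound r t 2))
    where
    size : ∀ y → r < t + (2 + y * 2) → r + 1 ≤ t + 2 * (y + 1)
    size y h = ≤-by h (solve (r ∷ t ∷ y ∷ []))

  case₂ : 3 * t ≤ r → 7 * r ≤ 26 * t → RAtMost r t (2 * r + 2 ∸ 5 * t)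
  case₂ r≥ _ = bounded 1≤t λ m → sufficient₂ r t _ m r≥ (m≤n+m∸n (2 * r + 2) (5 * t))

  case₃ : 26 * t ≤ 7 * r → r ≤ 5 * t ∸ 2 → RAtMost r t ((9 * r ∸ 14 * t) / 8 + 2)
  case₃ r≥ r≤ = bounded 1≤t λ m → sufficient₃ r t _ m r≥
    (m≤o∸n⇒m+n≤o r (≤-trans (s≤s (s≤s z≤n)) (5 ⊗ 1≤t)) r≤)
    (size ((9 * r ∸ 14 * t) / 8) (floor-bound (9 * r) (14 * t) 8))
    where
    size : ∀ y → 9 * r < 14 * t + (8 + y * 8) → 9 * r + 9 ≤ 14 * t + 8 * (y + 2)
    size y h = ≤-by h (solve (r ∷ t ∷ y ∷ []))

  case₄ : 5 * t ∸ 1 ≤ r → 9 * r ≤ 52 * t ∸ 13 → RAtMost r t ((15 * r ∸ 44 * t) / 8 + 3)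
  case₄ r≥ r≤ = bounded 1≤t λ m → sufficient₄ r t _ m
    (≤-trans (m≤n+m∸n (5 * t) 1) (≤-trans (s≤s r≥) (≤-reflexive (+-comm 1 r))))
    (m≤o∸n⇒m+n≤o (9 * r) (≤-trans (m≤m+n 13 39) (52 ⊗ 1≤t)) r≤)
    (size ((15 * r ∸ 44 * t) / 8) (floor-bound (15 * r) (44 * t) 8))
    where
    size : ∀ y → 15 * r < 44 * t + (8 + y * 8) → 15 * r + 17 ≤ 44 * t + 8 * (y + 3)
    -- The added 3 contributes 24: 8 for the remainder and 16 to raise the constant from 1 to 17.
    size y h = ≤-by h (solve (r ∷ t ∷ y ∷ []))
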